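{- Let $G$ be an OD-admissible graph of order $n$ and let $k = \lceil \log_2 n \rceil \ge 3$. Then $\gamma^{\mathrm{OD}}(G) = k$ if and only if $G$ can be obtained (up to isomorphism) from some graph $G^O(k) = (C \cup (V \setminus C), E)$ by removing up to $2^{k-1}-1$ vertices of $V \setminus C$ if $G^O(k)[C]$ has an isolated vertex, and up to $2^{k-1}-2$ vertices of $V \setminus C$ otherwise.
   Context: Graphs are finite, simple and undirected. For a graph $G=(V,E)$ and $v\in V$, $N(v)$ is the open neighborhood and $N[v]=N(v)\cup\{v\}$ the closed neighborhood; $G[C]$ is the subgraph induced by $C$. Open twins are distinct non-adjacent vertices $u,v$ with $N(u)=N(v)$. A set $C\subseteq V$ is dominating if $N[v]\cap C\neq\emptyset$ for all $v\in V$, and open-separating if $N(u)\cap C\neq N(v)\cap C$ for all distinct $u,v\in V$ (the set $N(v)\cap C$ may be empty for at most one vertex). An OD-code is a set that is both open-separating and dominating. A graph is OD-admissible if it has an OD-code; $\gamma^{\mathrm{OD}}(G)$ is the minimum cardinality of an OD-code of $G$. For $k\ge 2$, $G^O(k)$ denotes any graph with vertex set $V$ and a subset $C\subseteq V$ such that $|C|=k$, the induced subgraph $G^O(k)[C]$ has no open twins, and $V\setminus C$ consists of exactly one vertex $v_{C'}$ with $N(v_{C'})\cap C=C'$ for each non-empty subset $C'\subseteq C$ such that there is no vertex $u\in C$ with $N(u)\cap C=C'$; there is no condition on the edges inside $V\setminus C$. -}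

module Defs where

open import Data.Bool.Properties using () renaming (_≟_ to _≟ᵇ_)
open import Data.Fin using (Fin; zero; suc)
open import Data.Fin.Properties using (_≟_; all?)
open import Data.Fin.Subset
  using (Subset; inside; outside; _∈_; _∉_; _⊆_; _∩_; _∪_; ⁅_⁆; ∣_∣; Nonempty; Empty)
open import Data.Fin.Subset.Properties using (nonempty?; anySubset?)
open import Data.Nat using (ℕ; _≤_; _<_)
open import Data.Nat.Induction using (<-wellFounded)
open import Data.Nat.Properties using (_<?_; ≮⇒≥)
open import Data.Product using (∃; ∃!; _×_; _,_; proj₁)
open import Data.Vec using ([]; _∷_; tabulate)
open import Data.Vec.Properties using (≡-dec)
open import Function.Bundles using (_⇔_; _⤖_; Bijection)
open import Induction.WellFounded using (Acc; acc)
open import Level using (0ℓ)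
open import Relation.Binary.Core using (Rel)
open import Relation.Binary.Definitions using (Decidable; Symmetric; Irreflexive; DecidableEquality)
open import Relation.Binary.PropositionalEquality using (_≡_; _≢_)
open import Relation.Nullary using (¬_; Dec; yes; no; does; ¬?; _×-dec_; _→-dec_)

private
  variable
    m n : ℕ

record Graph (n : ℕ) : Set₁ where
  infix 4 _~_ _~?_
  field
    _~_      : Rel (Fin n) 0ℓ
    _~?_     : Decidable _~_
    ~-sym    : Symmetric _~_
    ~-irrefl : Irreflexive _≡_ _~_

  N : Fin n → Subset n
  N v = tabulate (λ u → does (v ~? u))

  N[_] : Fin n → Subset n
  N[ v ] = ⁅ v ⁆ ∪ N v

-- The elements of C in increasing order.
elements : (C : Subset n) → Fin ∣ C ∣ → Fin n
elements (outside ∷ C) i       = suc (elements C i)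
elements (inside  ∷ C) zero    = zero
elements (inside  ∷ C) (suc i) = suc (elements C i)

-- The induced subgraph G[C], its vertices renumbered along `elements C`.
infix 8 _[_]
_[_] : Graph n → (C : Subset n) → Graph ∣ C ∣
G [ C ] = record
  { _~_      = λ i j → elements C i ~ elements C j
  ; _~?_     = λ i j → elements C i ~? elements C j
  ; ~-sym    = ~-sym
  ; ~-irrefl = λ { _≡_.refl → ~-irrefl _≡_.refl }
  }
  where open Graph G

infix 4 _≅_
record _≅_ (G : Graph n) (H : Graph m) : Set where
  private
    module G = Graph G
    module H = Graph H
  field
    bijection : Fin n ⤖ Fin m
  open Bijection bijection public using (to)
  field
    adjacency : ∀ u v → u G.~ v ⇔ to u H.~ to v

module _ (G : Graph n) where
  open Graph G

  Isolated : Fin n → Set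
  Isolated v = Empty (N v)

  HasIsolatedVertex : Set
  HasIsolatedVertex = ∃ Isolated

  OpenTwins : Fin n → Fin n → Set
  OpenTwins u v = u ≢ v × ¬ (u ~ v) × N u ≡ N v

  OpenTwinFree : Set
  OpenTwinFree = ∀ u v → ¬ OpenTwins u v

  Dominating : Subset n → Set
  Dominating C = ∀ v → Nonempty (N[ v ] ∩ C)

  OpenSeparating : Subset n → Set
  OpenSeparating C = ∀ u v → u ≢ v → N u ∩ C ≢ N v ∩ C

  ODCode : Subset n → Set
  ODCode C = OpenSeparating C × Dominating C

  ODAdmissible : Set
  ODAdmissible = ∃ ODCode

  MinimumODCode : Subset n → Set
  MinimumODCode C = ODCode C × (∀ D → ODCode D → ∣ C ∣ ≤ ∣ D ∣)

_≟ˢ_ : DecidableEquality (Subset n)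
_≟ˢ_ = ≡-dec _≟ᵇ_

odCode? : (G : Graph n) (C : Subset n) → Dec (ODCode G C)
odCode? G C =
  all? (λ u → all? (λ v → ¬? (u ≟ v) →-dec ¬? ((N u ∩ C) ≟ˢ (N v ∩ C))))
    ×-dec all? (λ v → nonempty? (N[ v ] ∩ C))
  where open Graph G

minimumODCode : (G : Graph n) → ODAdmissible G → ∃ (MinimumODCode G)
minimumODCode {n} G (C₀ , code₀) = descend C₀ code₀ (<-wellFounded ∣ C₀ ∣)
  where
  descend : (C : Subset n) → ODCode G C → Acc _<_ ∣ C ∣ → ∃ (MinimumODCode G)
  descend C code (acc rec)
    with anySubset? (λ D → odCode? G D ×-dec (∣ D ∣ <? ∣ C ∣))
  ... | yes (D , codeD , D<C) = descend D codeD (rec D<C)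
  ... | no  none              = C , code , λ D codeD → ≮⇒≥ (λ D<C → none (D , codeD , D<C))

γᴼᴰ : (G : Graph n) → ODAdmissible G → ℕ
γᴼᴰ G admissible = ∣ proj₁ (minimumODCode G admissible) ∣

module _ (H : Graph n) (C : Subset n) where
  open Graph H

  Missing : Subset n → Set
  Missing C′ = C′ ⊆ C × Nonempty C′ × ¬ (∃ λ u → u ∈ C × N u ∩ C ≡ C′)

  -- H is a graph Gᴼ(k) with distinguished subset C.
  record IsGᴼ (k : ℕ) : Set where
    field
      2≤k          : 2 ≤ k
      ∣C∣≡k        : ∣ C ∣ ≡ k
      openTwinFree : OpenTwinFree (H [ C ])
      exactlyOne   : ∀ C′ → Missing C′ → ∃! _≡_ (λ v → v ∉ C × N v ∩ C ≡ C′)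
      noOthers     : ∀ v → v ∉ C → Missing (N v ∩ C)

-- A set C of k vertices is an OD-code exactly when the traces N(v) ∩ C are
-- pairwise distinct and only vertices of C may have the empty trace.  Hence an
-- OD-code of size k allows at most 2 ^ k vertices, which bounds γ from below by
-- ⌈log₂ n⌉; and a graph with an OD-code C of that size becomes a graph Gᴼ(k)
-- by adding one vertex for each non-empty subset of C that is not yet a trace.
-- The number of added vertices is bounded by counting traces once more: when
-- G[C] has no isolated vertex, the empty trace stays unused.
module Submission where

open import Defs
import Data.Empty as Empty
open import Data.Fin using (Fin; zero; suc; _↑ˡ_; splitAt; join)
open import Data.Fin.Properties
  using (_≟_; any?; suc-injective; injective⇒≤; 2↔Bool; *↔×; ↑ˡ-injective; splitAt-↑ˡ
        ; join-splitAt; splitAt-join)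
open import Data.Fin.Subset using (Subset; inside; outside; _∈_; _∉_; _⊆_; _∩_; ∁; ∣_∣; ⁅_⁆; Nonempty; ⊤; ⊥)
open import Data.Fin.Subset.Properties
  using (_∈?_; _⊆?_; nonempty?; ⊆-antisym; ∈⊤; ∉⊥; x∈⁅x⁆; x∈⁅y⁆⇒x≡y; x∈p∩q⁺; x∈p∩q⁻; x∈p∪q⁺; x∈p∪q⁻; p∩q⊆q
        ; x∈p⇒x∉∁p; x∉p⇒x∈∁p; x∈∁p⇒x∉p; x∉∁p⇒x∈p; ∣∁p∣≡n∸∣p∣; ∣⊤∣≡n)
open import Data.Nat using (ℕ; zero; suc; _+_; _≤_; _<_; _∸_; _^_; z≤n; s≤s)
open import Data.Nat.Logarithm using (⌈log₂_⌉; ⌈log₂⌉-mono-≤; ⌈log₂2^n⌉≡n)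
open import Data.Nat.Properties
  using (≤-trans; ≤-antisym; ≤-reflexive; ≰⇒>; 1+n≰n; ∸-mono; m+n∸m≡n
        ; m+n≤o⇒m≤o∸n; +-identityʳ; +-comm; +-suc; ∸-+-assoc; module ≤-Reasoning)
open import Data.Product using (Σ; ∃; _×_; _,_; proj₁; proj₂; uncurry)
open import Data.Product.Function.NonDependent.Propositional using (_×-↔_)
open import Data.Sum using (_⊎_; inj₁; inj₂; [_,_])
open import Data.Vec using ([]; _∷_; head; tail; here; there; tabulate)
open import Data.Vec.Properties using ([]=⇒lookup; lookup⇒[]=; lookup∘tabulate)
open import Data.Bool using (Bool)
open import Function using (_∘_)
open import Function.Bundles using (_⇔_; _↔_; mk⇔; mk↔ₛ′; mk⤖; Equivalence; Inverse; Bijection)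
open import Function.Construct.Composition using (_↔-∘_)
open import Function.Definitions using (Injective)
open import Relation.Binary.PropositionalEquality using (_≡_; _≢_; refl; sym; trans; cong; cong₂; subst)
open import Relation.Nullary using (¬_; Dec; yes; no; does; ¬?; _×-dec_; contradiction)
open import Relation.Nullary.Decidable using (dec-true; decidable-stable)
open import Relation.Unary using (Pred; Decidable)
open import Level using (0ℓ)

open Equivalence using (to; from)

private
  variable
    a m n k r : ℕ

-- Subsets given by predicates, images and preimages.

⟪_⟫ : {P : Pred (Fin n) 0ℓ} → Decidable P → Subset n
⟪ P? ⟫ = tabulate (does ∘ P?)

∈⟪⟫⁺ : {P : Pred (Fin n) 0ℓ} (P? : Decidable P) {i : Fin n} → P i → i ∈ ⟪ P? ⟫
∈⟪⟫⁺ P? {i} p = lookup⇒[]= i _ (trans (lookup∘tabulate _ i) (dec-true (P? i) p))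

∈⟪⟫⁻ : {P : Pred (Fin n) 0ℓ} (P? : Decidable P) {i : Fin n} → i ∈ ⟪ P? ⟫ → P i
∈⟪⟫⁻ P? {i} i∈ with P? i | trans (sym (lookup∘tabulate (does ∘ P?) i)) ([]=⇒lookup i∈)
... | yes p | _  = p
... | no  _ | ()

image? : (f : Fin m → Fin n) (C : Subset m) → Decidable (λ w → ∃ λ v → v ∈ C × f v ≡ w)
image? f C w = any? λ v → (v ∈? C) ×-dec (f v ≟ w)

image : (Fin m → Fin n) → Subset m → Subset n
image f C = ⟪ image? f C ⟫

∈image⁺ : (f : Fin m → Fin n) {C : Subset m} {v : Fin m} → v ∈ C → f v ∈ image f C
∈image⁺ f {C} v∈C = ∈⟪⟫⁺ (image? f C) (_ , v∈C , refl)

∈image⁻ : (f : Fin m → Fin n) {C : Subset m} {w : Fin n} → w ∈ image f C → ∃ λ v → v ∈ C × f v ≡ w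
∈image⁻ f {C} = ∈⟪⟫⁻ (image? f C)

preimage : (Fin m → Fin n) → Subset n → Subset m
preimage f C = ⟪ (λ v → f v ∈? C) ⟫

∈preimage⁺ : (f : Fin m → Fin n) {C : Subset n} {v : Fin m} → f v ∈ C → v ∈ preimage f C
∈preimage⁺ f {C} = ∈⟪⟫⁺ (λ v → f v ∈? C)

∈preimage⁻ : (f : Fin m → Fin n) {C : Subset n} {v : Fin m} → v ∈ preimage f C → f v ∈ C
∈preimage⁻ f {C} = ∈⟪⟫⁻ (λ v → f v ∈? C)

image-⊆⁻ : {f : Fin m → Fin n} → Injective _≡_ _≡_ f → {C D : Subset m} → image f C ⊆ image f D → C ⊆ D
image-⊆⁻ {f = f} f-inj C⊆D v∈C with ∈image⁻ f (C⊆D (∈image⁺ f v∈C))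
... | _ , w∈D , eq = subst (_∈ _) (f-inj eq) w∈D

image-injective : {f : Fin m → Fin n} → Injective _≡_ _≡_ f → Injective _≡_ _≡_ (image f)
image-injective f-inj eq = ⊆-antisym
  (image-⊆⁻ f-inj (subst (_ ∈_) eq)) (image-⊆⁻ f-inj (subst (_ ∈_) (sym eq)))

-- Enumerating a subset and counting by injections.

elements-∈ : (C : Subset n) (i : Fin ∣ C ∣) → elements C i ∈ C
elements-∈ (outside ∷ C) i       = there (elements-∈ C i)
elements-∈ (inside  ∷ C) zero    = here
elements-∈ (inside  ∷ C) (suc i) = there (elements-∈ C i)

elements-injective : (C : Subset n) → Injective _≡_ _≡_ (elements C)
elements-injective (outside ∷ C)                 eq = elements-injective C (suc-injective eq)
elements-injective (inside  ∷ C) {zero}  {zero}  eq = refl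
elements-injective (inside  ∷ C) {suc i} {suc j} eq = cong suc (elements-injective C (suc-injective eq))

index : {C : Subset n} {v : Fin n} → v ∈ C → ∃ λ i → elements C i ≡ v
index {C = inside  ∷ C} here        = zero , refl
index {C = outside ∷ C} (there v∈C) = let i , eq = index v∈C in i , cong suc eq
index {C = inside  ∷ C} (there v∈C) = let i , eq = index v∈C in suc i , cong suc eq

injective⇒≤∣∣ : (C : Subset n) (f : Fin a → Fin n) → Injective _≡_ _≡_ f → (∀ i → f i ∈ C) → a ≤ ∣ C ∣
injective⇒≤∣∣ C f f-inj f∈C = injective⇒≤ {f = λ i → proj₁ (index (f∈C i))} λ {i} {j} eq →
  f-inj (trans (sym (proj₂ (index (f∈C i)))) (trans (cong (elements C) eq) (proj₂ (index (f∈C j)))))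

-- One injection picks a preimage for each member of the image; the other is `f` itself on `C`.
∣image∣ : {f : Fin m → Fin n} → Injective _≡_ _≡_ f → (C : Subset m) → ∣ image f C ∣ ≡ ∣ C ∣
∣image∣ {f = f} f-inj C = ≤-antisym
  (injective⇒≤∣∣ C (proj₁ ∘ origin)
    (λ {i} {j} eq → elements-injective (image f C)
      (trans (sym (proj₂ (proj₂ (origin i)))) (trans (cong f eq) (proj₂ (proj₂ (origin j))))))
    (proj₁ ∘ proj₂ ∘ origin))
  (injective⇒≤∣∣ (image f C) (f ∘ elements C) (elements-injective C ∘ f-inj) (∈image⁺ f ∘ elements-∈ C))
  where
  origin : ∀ i → ∃ λ v → v ∈ C × f v ≡ elements (image f C) i
  origin i = ∈image⁻ f (elements-∈ (image f C) i)

∣preimage∣≤ : {f : Fin m → Fin n} → Injective _≡_ _≡_ f → (C : Subset n) → ∣ preimage f C ∣ ≤ ∣ C ∣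
∣preimage∣≤ {f = f} f-inj C = injective⇒≤∣∣ C (f ∘ elements (preimage f C)) (elements-injective (preimage f C) ∘ f-inj)
  (λ i → ∈preimage⁻ f (elements-∈ (preimage f C) i))

Fin2^n↔Subset : ∀ n → Fin (2 ^ n) ↔ Subset n
Fin2^n↔Subset zero    = mk↔ₛ′ (λ _ → []) (λ _ → zero) (λ { [] → refl }) (λ { zero → refl })
Fin2^n↔Subset (suc n) =
  cons ↔-∘ ((2↔Bool ×-↔ Fin2^n↔Subset n) ↔-∘ *↔×)
  where
  cons : (Bool × Subset n) ↔ Subset (suc n)
  cons = mk↔ₛ′ (uncurry _∷_) (λ v → head v , tail v) (λ { (b ∷ p) → refl }) (λ _ → refl)

-- Subsets of `C` lose nothing when pulled back along `elements C`, so they inject into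
-- `Subset ∣ C ∣`, which has `2 ^ ∣ C ∣` members.
subsets-≤-2^ : (C : Subset n) (f : Fin a → Subset n) → Injective _≡_ _≡_ f → (∀ i → f i ⊆ C) → a ≤ 2 ^ ∣ C ∣
subsets-≤-2^ C f f-inj f⊆C =
  injective⇒≤ {f = Inverse.from (Fin2^n↔Subset ∣ C ∣) ∘ preimage (elements C) ∘ f} λ {i} {j} eq →
    let eq′ = trans (sym (Inverse.strictlyInverseˡ (Fin2^n↔Subset ∣ C ∣) _))
                (trans (cong (Inverse.to (Fin2^n↔Subset ∣ C ∣)) eq)
                  (Inverse.strictlyInverseˡ (Fin2^n↔Subset ∣ C ∣) _))
    in f-inj (⊆-antisym (restrict-⊆⁻ (f⊆C i) eq′) (restrict-⊆⁻ (f⊆C j) (sym eq′)))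
  where
  restrict-⊆⁻ : {D E : Subset _} → D ⊆ C → preimage (elements C) D ≡ preimage (elements C) E → D ⊆ E
  restrict-⊆⁻ D⊆C eq x∈D with index (D⊆C x∈D)
  ... | i , refl = ∈preimage⁻ (elements C) (subst (i ∈_) eq (∈preimage⁺ (elements C) x∈D))

-- Traces on a set of vertices and OD-codes.

module _ (G : Graph n) where
  open Graph G

  ∈N∩⁺ : (C : Subset n) {u v : Fin n} → u ~ v → v ∈ C → v ∈ N u ∩ C
  ∈N∩⁺ C {u} u~v v∈C = x∈p∩q⁺ (∈⟪⟫⁺ (u ~?_) u~v , v∈C)

  ∈N∩⁻ : (C : Subset n) {u v : Fin n} → v ∈ N u ∩ C → u ~ v × v ∈ C
  ∈N∩⁻ C {u} v∈ = let v∈N , v∈C = x∈p∩q⁻ (N u) C v∈ in ∈⟪⟫⁻ (u ~?_) v∈N , v∈C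

  trace⊆C : (C : Subset n) (v : Fin n) → N v ∩ C ⊆ C
  trace⊆C C v = p∩q⊆q (N v) C

  -- Contrapositive of `OpenSeparating`, in the form that the counting lemmas take.
  TraceInjective : Subset n → Set
  TraceInjective C = Injective _≡_ _≡_ (λ v → N v ∩ C)

  -- This is all that domination demands: vertices of `C` dominate themselves, and any other vertex
  -- needs a neighbor in `C`.
  TraceNonempty : Subset n → Set
  TraceNonempty C = ∀ {v} → v ∉ C → Nonempty (N v ∩ C)

  odCode⁺ : (C : Subset n) → TraceInjective C → TraceNonempty C → ODCode G C
  odCode⁺ C inj nonempty = (λ _ _ u≢v → u≢v ∘ inj) , dominate
    where
    dominate : Dominating G C
    dominate v with v ∈? C
    ... | yes v∈C = v , x∈p∩q⁺ (x∈p∪q⁺ (inj₁ (x∈⁅x⁆ v)) , v∈C)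
    ... | no  v∉C = let u , u∈ = nonempty v∉C ; u∈N , u∈C = x∈p∩q⁻ (N v) C u∈ in
      u , x∈p∩q⁺ (x∈p∪q⁺ (inj₂ u∈N) , u∈C)

  odCode⇒traceInjective : (C : Subset n) → ODCode G C → TraceInjective C
  odCode⇒traceInjective C (separating , _) {u} {v} eq = decidable-stable (u ≟ v) λ u≢v → separating u v u≢v eq

  odCode⇒traceNonempty : (C : Subset n) → ODCode G C → TraceNonempty C
  odCode⇒traceNonempty C (_ , dominating) {v} v∉C with dominating v
  ... | u , u∈ with x∈p∩q⁻ N[ v ] C u∈
  ... | u∈N[v] , u∈C with x∈p∪q⁻ ⁅ v ⁆ (N v) u∈N[v]
  ... | inj₁ u∈⁅v⁆ = contradiction (subst (_∈ C) (x∈⁅y⁆⇒x≡y v u∈⁅v⁆) u∈C) v∉C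
  ... | inj₂ u∈N   = u , x∈p∩q⁺ (u∈N , u∈C)

  odCode⇒n≤2^ : (C : Subset n) → ODCode G C → n ≤ 2 ^ ∣ C ∣
  odCode⇒n≤2^ C code = subsets-≤-2^ C _ (odCode⇒traceInjective C code) (trace⊆C C)

  -- Up to renumbering, neighborhoods in `G [ C ]` are the traces of vertices of `C`; this and the
  -- next three lemmas translate membership and inclusion.
  ∈N[C]⁺ : (C : Subset n) {i j : Fin ∣ C ∣} → elements C j ∈ N (elements C i) ∩ C → j ∈ Graph.N (G [ C ]) i
  ∈N[C]⁺ C {i} j∈ = ∈⟪⟫⁺ (Graph._~?_ (G [ C ]) i) (proj₁ (∈N∩⁻ C j∈))

  ∈N[C]⁻ : (C : Subset n) {i j : Fin ∣ C ∣} → j ∈ Graph.N (G [ C ]) i → elements C j ∈ N (elements C i) ∩ C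
  ∈N[C]⁻ C {i} {j} j∈ = ∈N∩⁺ C (∈⟪⟫⁻ (Graph._~?_ (G [ C ]) i) j∈) (elements-∈ C j)

  trace-⊆ : (C : Subset n) {i j : Fin ∣ C ∣} →
    Graph.N (G [ C ]) i ⊆ Graph.N (G [ C ]) j → N (elements C i) ∩ C ⊆ N (elements C j) ∩ C
  trace-⊆ C {i} N⊆N {x} x∈ with index (proj₂ (∈N∩⁻ C x∈))
  ... | _ , refl = ∈N[C]⁻ C (N⊆N (∈N[C]⁺ C x∈))

  N[C]-⊆ : (C : Subset n) {i j : Fin ∣ C ∣} →
    N (elements C i) ∩ C ⊆ N (elements C j) ∩ C → Graph.N (G [ C ]) i ⊆ Graph.N (G [ C ]) j
  N[C]-⊆ C tr⊆tr x∈ = ∈N[C]⁺ C (tr⊆tr (∈N[C]⁻ C x∈))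

  -- The empty set joins the traces as one more subset of `C`. It is no trace itself: for a vertex
  -- outside `C` domination forbids it, and a vertex of `C` with empty trace would be isolated in
  -- `G [ C ]`.
  odCode⇒suc-n≤2^ : (C : Subset n) → ODCode G C → ¬ HasIsolatedVertex (G [ C ]) → suc n ≤ 2 ^ ∣ C ∣
  odCode⇒suc-n≤2^ C code noIsolated = subsets-≤-2^ C trace⊎⊥ injective ⊆C
    where
    trace⊎⊥ : Fin (suc n) → Subset n
    trace⊎⊥ zero    = ⊥
    trace⊎⊥ (suc v) = N v ∩ C

    trace≢⊥ : ∀ v → N v ∩ C ≢ ⊥
    trace≢⊥ v eq with v ∈? C
    ... | no  v∉C = let u , u∈ = odCode⇒traceNonempty C code v∉C in ∉⊥ (subst (u ∈_) eq u∈)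
    ... | yes v∈C with index v∈C
    ...   | i , refl = noIsolated (i , λ (_ , j∈) → ∉⊥ (subst (_ ∈_) eq (∈N[C]⁻ C j∈)))

    injective : Injective _≡_ _≡_ trace⊎⊥
    injective {zero}  {zero}  eq = refl
    injective {zero}  {suc v} eq = contradiction (sym eq) (trace≢⊥ v)
    injective {suc u} {zero}  eq = contradiction eq (trace≢⊥ u)
    injective {suc u} {suc v} eq = cong suc (odCode⇒traceInjective C code eq)

    ⊆C : ∀ i → trace⊎⊥ i ⊆ C
    ⊆C zero    = λ x∈⊥ → contradiction x∈⊥ ∉⊥
    ⊆C (suc v) = trace⊆C C v

  -- Two vertices with equal traces are compared by position. One inside and one outside `C`
  -- contradict `noOthers`; two outside are equal by the uniqueness in `exactlyOne`; two distinct
  -- ones inside would be open twins of `G [ C ]`.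
  isGᴼ⇒odCode : (C : Subset n) → IsGᴼ G C k → ODCode G C
  isGᴼ⇒odCode C isGᴼ = odCode⁺ C injective λ {v} v∉C → proj₁ (proj₂ (noOthers v v∉C))
    where
    open IsGᴼ isGᴼ

    injective : TraceInjective C
    injective {u} {v} eq with u ∈? C | v ∈? C
    ... | yes u∈C | no  v∉C = contradiction (u , u∈C , eq) (proj₂ (proj₂ (noOthers v v∉C)))
    ... | no  u∉C | yes v∈C = contradiction (v , v∈C , sym eq) (proj₂ (proj₂ (noOthers u u∉C)))
    ... | no  u∉C | no  v∉C =
      let _ , _ , unique = exactlyOne _ (noOthers u u∉C) in
      trans (sym (unique (u∉C , refl))) (unique (v∉C , sym eq))
    ... | yes u∈C | yes v∈C with index u∈C | index v∈C
    ...   | i , refl | j , refl = cong (elements C) (decidable-stable (i ≟ j) λ i≢j → openTwinFree i j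
      ( i≢j
      -- As the traces agree, an edge between `i` and `j` would put `elements C j` into its own
      -- neighborhood.
      , (λ i~j → ~-irrefl refl (proj₁ (∈N∩⁻ C (subst (_ ∈_) eq (∈N∩⁺ C i~j (elements-∈ C j))))))
      , ⊆-antisym (N[C]-⊆ C (subst (_ ∈_) eq)) (N[C]-⊆ C (subst (_ ∈_) (sym eq)))))

  -- Injectivity of traces excludes open twins, makes the vertex with a given trace unique, and
  -- keeps traces of outside vertices apart from those of `C`. Existence of the vertices comes from
  -- the last hypothesis.
  odCode⇒isGᴼ : (C : Subset n) → 2 ≤ ∣ C ∣ → ODCode G C →
    (∀ D → D ⊆ C → Nonempty D → ∃ λ v → N v ∩ C ≡ D) → IsGᴼ G C ∣ C ∣
  odCode⇒isGᴼ C 2≤∣C∣ code realise = record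
    { 2≤k          = 2≤∣C∣
    ; ∣C∣≡k        = refl
    ; openTwinFree = λ i j (i≢j , _ , eq) → i≢j (elements-injective C (injective
        (⊆-antisym (trace-⊆ C (subst (_ ∈_) eq)) (trace-⊆ C (subst (_ ∈_) (sym eq))))))
    ; exactlyOne   = λ D (D⊆C , D≢∅ , notInC) →
        let v , eq = realise D D⊆C D≢∅ in
        -- A missing set is the trace of no vertex of `C`, so the realising vertex lies outside.
        v , ((λ v∈C → notInC (v , v∈C , eq)) , eq) , λ (_ , eq′) → injective (trans eq (sym eq′))
    ; noOthers     = λ v v∉C →
        trace⊆C C v , odCode⇒traceNonempty C code v∉C ,
        λ (u , u∈C , eq) → v∉C (subst (_∈ C) (injective eq) u∈C)
    }
    where
    injective = odCode⇒traceInjective C code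

-- Embeddings as induced subgraphs.

record Embedding (G : Graph n) (H : Graph m) : Set where
  private
    module G = Graph G
    module H = Graph H
  field
    emb       : Fin n → Fin m
    injective : Injective _≡_ _≡_ emb
    adjacency : ∀ u v → u G.~ v ⇔ emb u H.~ emb v

module _ {G : Graph n} {H : Graph m} (ι : Embedding G H) where
  private
    module G = Graph G
    module H = Graph H
  open Embedding ι

  -- Every neighbor in `C` of an embedded vertex comes from `G`, because `C` lies in the range of
  -- `emb`. Traces thus correspond on both sides, and distinctness and non-emptiness pass to `G`.
  odCode-preimage : (C : Subset m) → (∀ {w} → w ∈ C → ∃ λ v → emb v ≡ w) →
    ODCode H C → ODCode G (preimage emb C)
  odCode-preimage C C⊆emb code = odCode⁺ G D
    (λ eq → injective (odCode⇒traceInjective H C code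
      (⊆-antisym (trace-⊆⁻ (subst (_ ∈_) eq)) (trace-⊆⁻ (subst (_ ∈_) (sym eq))))))
    nonempty
    where
    D : Subset n
    D = preimage emb C

    trace⁺ : ∀ {u x} → emb x ∈ H.N (emb u) ∩ C → x ∈ G.N u ∩ D
    trace⁺ x∈ = let u~x , x∈C = ∈N∩⁻ H C x∈ in ∈N∩⁺ G D (adjacency _ _ .from u~x) (∈preimage⁺ emb x∈C)

    trace⁻ : ∀ {u x} → x ∈ G.N u ∩ D → emb x ∈ H.N (emb u) ∩ C
    trace⁻ x∈ = let u~x , x∈D = ∈N∩⁻ G D x∈ in ∈N∩⁺ H C (adjacency _ _ .to u~x) (∈preimage⁻ emb x∈D)

    trace-⊆⁻ : ∀ {u v} → G.N u ∩ D ⊆ G.N v ∩ D → H.N (emb u) ∩ C ⊆ H.N (emb v) ∩ C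
    trace-⊆⁻ tr⊆tr w∈ with C⊆emb (proj₂ (∈N∩⁻ H C w∈))
    ... | _ , refl = trace⁻ (tr⊆tr (trace⁺ w∈))

    nonempty : TraceNonempty G D
    nonempty v∉D with odCode⇒traceNonempty H C code (v∉D ∘ ∈preimage⁺ emb)
    ... | _ , w∈ with C⊆emb (proj₂ (∈N∩⁻ H C w∈))
    ... | x , refl = x , trace⁺ w∈

  embedding⇒≅ : (S : Subset m) → (∀ v → emb v ∈ S) → (∀ {w} → w ∈ S → ∃ λ v → emb v ≡ w) → G ≅ H [ S ]
  embedding⇒≅ S emb∈S S⊆emb = record
    { bijection = mk⤖
        ( (λ {u} {v} eq → injective (trans (sym (elements-pos u)) (trans (cong (elements S) eq) (elements-pos v))))
        , (λ i → let v , eq = S⊆emb (elements-∈ S i) in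
            v , λ { refl → elements-injective S (trans (elements-pos v) eq) }))
    ; adjacency = λ u v → subst (u G.~ v ⇔_)
        (sym (cong₂ H._~_ (elements-pos u) (elements-pos v))) (adjacency u v)
    }
    where
    pos : Fin n → Fin ∣ S ∣
    pos v = proj₁ (index (emb∈S v))

    elements-pos : ∀ v → elements S (pos v) ≡ emb v
    elements-pos v = proj₂ (index (emb∈S v))

≅⇒embedding : {G : Graph n} {H : Graph m} (S : Subset m) → G ≅ H [ S ] →
  Σ (Embedding G H) λ ι → ∀ {w} → w ∈ S → ∃ λ v → Embedding.emb ι v ≡ w
≅⇒embedding S iso = record
  { emb       = elements S ∘ iso.to
  ; injective = Bijection.injective iso.bijection ∘ elements-injective S
  ; adjacency = iso.adjacency
  } , λ w∈S → let i , elements≡w = index w∈S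
                  v , to≡i       = Bijection.strictlySurjective iso.bijection i
              in v , trans (cong (elements S) to≡i) elements≡w
  where
  module iso = _≅_ iso

-- Adding vertices with prescribed traces.

module Extension (G : Graph n) (C : Subset n) (T : Fin r → Subset n) (T⊆C : ∀ j → T j ⊆ C) where
  private
    module G = Graph G

  -- Left summands are the vertices of `G`, right summands the added ones. No edges are put among
  -- added vertices, a free choice since `IsGᴼ` only constrains traces on `C`.
  Adj : Fin n ⊎ Fin r → Fin n ⊎ Fin r → Set
  Adj (inj₁ u) (inj₁ v) = u G.~ v
  Adj (inj₁ u) (inj₂ j) = u ∈ T j
  Adj (inj₂ j) (inj₁ u) = u ∈ T j
  Adj (inj₂ _) (inj₂ _) = Empty.⊥

  adj? : ∀ x y → Dec (Adj x y)
  adj? (inj₁ u) (inj₁ v) = u G.~? v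
  adj? (inj₁ u) (inj₂ j) = u ∈? T j
  adj? (inj₂ j) (inj₁ u) = u ∈? T j
  adj? (inj₂ _) (inj₂ _) = no λ ()

  adj-sym : ∀ x y → Adj x y → Adj y x
  adj-sym (inj₁ u) (inj₁ v) = G.~-sym
  adj-sym (inj₁ u) (inj₂ j) u∈T = u∈T
  adj-sym (inj₂ j) (inj₁ u) u∈T = u∈T

  adj-irrefl : ∀ x → ¬ Adj x x
  adj-irrefl (inj₁ u) = G.~-irrefl refl
  adj-irrefl (inj₂ j) ()

  H : Graph (n + r)
  H = record
    { _~_      = λ x y → Adj (splitAt n x) (splitAt n y)
    ; _~?_     = λ x y → adj? (splitAt n x) (splitAt n y)
    ; ~-sym    = λ {x} {y} → adj-sym (splitAt n x) (splitAt n y)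
    ; ~-irrefl = λ { {x} refl → adj-irrefl (splitAt n x) }
    }

  private
    module H = Graph H

  old : Fin n → Fin (n + r)
  old = _↑ˡ r

  old-injective : Injective _≡_ _≡_ old
  old-injective = ↑ˡ-injective r _ _

  G↪H : Embedding G H
  G↪H = record
    { emb       = old
    ; injective = old-injective
    ; adjacency = λ u v → subst (u G.~ v ⇔_)
        (sym (cong₂ Adj (splitAt-↑ˡ n u r) (splitAt-↑ˡ n v r))) (mk⇔ (λ p → p) (λ p → p))
    }

  C⁺ : Subset (n + r)
  C⁺ = image old C

  -- Traces of `H` expressed inside `G`: as `T j ⊆ C`, the added vertex `j` has trace exactly `T j`.
  -- The transport along `old` is `trace-H`.
  trace : Fin n ⊎ Fin r → Subset n
  trace = [ (λ v → G.N v ∩ C) , T ]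

  trace⊆ : ∀ x → trace x ⊆ C
  trace⊆ (inj₁ v) = trace⊆C G C v
  trace⊆ (inj₂ j) = T⊆C j

  ∈trace⁺ : ∀ x {v} → v ∈ C → Adj x (inj₁ v) → v ∈ trace x
  ∈trace⁺ (inj₁ u) v∈C u~v = ∈N∩⁺ G C u~v v∈C
  ∈trace⁺ (inj₂ j) v∈C v∈T = v∈T

  ∈trace⁻ : ∀ x {v} → v ∈ trace x → Adj x (inj₁ v)
  ∈trace⁻ (inj₁ u) v∈ = proj₁ (∈N∩⁻ G C v∈)
  ∈trace⁻ (inj₂ j) v∈ = v∈

  trace-H : ∀ w → H.N w ∩ C⁺ ≡ image old (trace (splitAt n w))
  trace-H w = ⊆-antisym ⊆ˡ ⊆ʳ
    where
    ⊆ˡ : H.N w ∩ C⁺ ⊆ image old (trace (splitAt n w))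
    ⊆ˡ x∈ with ∈N∩⁻ H C⁺ x∈
    ... | w~x , x∈C⁺ with ∈image⁻ old x∈C⁺
    ... | v , v∈C , refl = ∈image⁺ old
      (∈trace⁺ (splitAt n w) v∈C (subst (Adj (splitAt n w)) (splitAt-↑ˡ n v r) w~x))

    ⊆ʳ : image old (trace (splitAt n w)) ⊆ H.N w ∩ C⁺
    ⊆ʳ x∈ with ∈image⁻ old x∈
    ... | v , v∈ , refl = ∈N∩⁺ H C⁺
      (subst (Adj (splitAt n w)) (sym (splitAt-↑ˡ n v r)) (∈trace⁻ (splitAt n w) v∈))
      (∈image⁺ old (trace⊆ (splitAt n w) v∈))

  module _ (code : ODCode G C) (T-injective : Injective _≡_ _≡_ T) (T-nonempty : ∀ j → Nonempty (T j))
           (T-new : ∀ j v → G.N v ∩ C ≢ T j) where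

    trace-injective : Injective _≡_ _≡_ trace
    trace-injective {inj₁ u} {inj₁ v} eq = cong inj₁ (odCode⇒traceInjective G C code eq)
    trace-injective {inj₁ u} {inj₂ j} eq = contradiction eq (T-new j u)
    trace-injective {inj₂ j} {inj₁ v} eq = contradiction (sym eq) (T-new j v)
    trace-injective {inj₂ i} {inj₂ j} eq = cong inj₂ (T-injective eq)

    -- On the sum type, lying outside `C⁺` reads: if `x` is an old vertex, it is not in `C`.
    trace-nonempty : ∀ x → (∀ {v} → x ≡ inj₁ v → v ∉ C) → Nonempty (trace x)
    trace-nonempty (inj₁ v) ∉C = odCode⇒traceNonempty G C code (∉C refl)
    trace-nonempty (inj₂ j) _  = T-nonempty j

    odCode-H : ODCode H C⁺
    odCode-H = odCode⁺ H C⁺ inj nonempty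
      where
      inj : TraceInjective H C⁺
      inj {u} {v} eq = trans (sym (join-splitAt n r u)) (trans (cong (join n r) split≡) (join-splitAt n r v))
        where
        split≡ : splitAt n u ≡ splitAt n v
        split≡ = trace-injective (image-injective old-injective (trans (sym (trace-H u)) (trans eq (trace-H v))))

      nonempty : TraceNonempty H C⁺
      nonempty {w} w∉C⁺ =
        let x , x∈ = trace-nonempty (splitAt n w) λ eq v∈C →
              w∉C⁺ (subst (_∈ C⁺) (trans (cong (join n r) (sym eq)) (join-splitAt n r w)) (∈image⁺ old v∈C))
        in old x , subst (old x ∈_) (sym (trace-H w)) (∈image⁺ old x∈)

  -- A subset of `C⁺` is the image of its preimage under `old`, so realising that preimage as a
  -- `trace` realises the subset in `H`.
  realise-H : (∀ D → D ⊆ C → Nonempty D → ∃ λ x → trace x ≡ D) →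
    ∀ D → D ⊆ C⁺ → Nonempty D → ∃ λ w → H.N w ∩ C⁺ ≡ D
  realise-H realise D D⊆C⁺ (x , x∈D) =
    let y , eq = realise (preimage old D) preimage⊆C preimage-nonempty in
    join n r y , trans (trace-H (join n r y))
      (trans (cong (image old ∘ trace) (splitAt-join n r y)) (trans (cong (image old) eq) image-preimage))
    where
    preimage⊆C : preimage old D ⊆ C
    preimage⊆C v∈ with ∈image⁻ old (D⊆C⁺ (∈preimage⁻ old v∈))
    ... | _ , u∈C , eq = subst (_∈ C) (old-injective eq) u∈C

    preimage-nonempty : Nonempty (preimage old D)
    preimage-nonempty with ∈image⁻ old (D⊆C⁺ x∈D)
    ... | v , _ , refl = v , ∈preimage⁺ old x∈D

    image-preimage : image old (preimage old D) ≡ D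
    image-preimage = ⊆-antisym ⊆ˡ ⊆ʳ
      where
      ⊆ˡ : image old (preimage old D) ⊆ D
      ⊆ˡ w∈ with ∈image⁻ old w∈
      ... | _ , v∈ , refl = ∈preimage⁻ old v∈

      ⊆ʳ : D ⊆ image old (preimage old D)
      ⊆ʳ w∈D with ∈image⁻ old (D⊆C⁺ w∈D)
      ... | _ , _ , refl = ∈image⁺ old (∈preimage⁺ old w∈D)

-- Enumerating the subsets that are not yet traces.

module NewTraces (G : Graph n) (C : Subset n) where
  open Graph G

  -- Unlike `Missing`, this rules out a vertex with trace `D` anywhere in `G`, not only in `C`: a
  -- trace already taken outside `C` must not get a second vertex.
  New : Subset n → Set
  New D = (D ⊆ C × Nonempty D) × ¬ ∃ λ v → N v ∩ C ≡ D

  realised? : ∀ D → Dec (∃ λ v → N v ∩ C ≡ D)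
  realised? D = any? λ v → (N v ∩ C) ≟ˢ D

  new? : ∀ D → Dec (New D)
  new? D = ((D ⊆? C) ×-dec nonempty? D) ×-dec ¬? (realised? D)

  open Inverse (Fin2^n↔Subset n)
    using (strictlyInverseˡ; strictlyInverseʳ) renaming (to to decode; from to encode)

  -- Subsets are coded as numbers below `2 ^ n`, so that `elements` lists the new ones without
  -- repetition and `Fin ∣ news ∣` can index the added vertices.
  news : Subset (2 ^ n)
  news = ⟪ new? ∘ decode ⟫

  newTrace : Fin ∣ news ∣ → Subset n
  newTrace = decode ∘ elements news

  newTrace-new : ∀ j → New (newTrace j)
  newTrace-new j = ∈⟪⟫⁻ (new? ∘ decode) (elements-∈ news j)

  newTrace-injective : Injective _≡_ _≡_ newTrace
  newTrace-injective eq = elements-injective news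
    (trans (sym (strictlyInverseʳ _)) (trans (cong encode eq) (strictlyInverseʳ _)))

  newTrace-surjective : ∀ {D} → New D → ∃ λ j → newTrace j ≡ D
  newTrace-surjective {D} new =
    let j , eq = index (∈⟪⟫⁺ (new? ∘ decode) {encode D} (subst New (sym (strictlyInverseˡ D)) new))
    in j , trans (cong decode eq) (strictlyInverseˡ D)

-- The bound on removals and the two directions.

GᴼRemoval : Graph n → ℕ → Set₁
GᴼRemoval G k =
  Σ ℕ λ m → Σ (Graph m) λ H → Σ (Subset m) λ C → IsGᴼ H C k ×
    (Σ (Subset m) λ R → R ⊆ ∁ C ×
      (HasIsolatedVertex (H [ C ]) → ∣ R ∣ ≤ 2 ^ (k ∸ 1) ∸ 1) ×
      (¬ HasIsolatedVertex (H [ C ]) → ∣ R ∣ ≤ 2 ^ (k ∸ 1) ∸ 2) ×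
      G ≅ H [ ∁ R ])

-- Here `j` counts the subsets of the code kept free of traces. There are at most `2 ^ k ∸ j`
-- vertices in total and at least `2 ^ (k ∸ 1) + 1` of them stay.
removal-bound : ∀ j → 1 ≤ k → 2 ^ (k ∸ 1) < n → j + m ≤ 2 ^ k → m ∸ n ≤ 2 ^ (k ∸ 1) ∸ suc j
removal-bound {suc k} {n} {m} j _ 2^k<n j+m≤2^ = begin
  m ∸ n                              ≤⟨ ∸-mono (m+n≤o⇒m≤o∸n m (≤-trans (≤-reflexive (+-comm m j)) j+m≤2^)) 2^k<n ⟩
  2 ^ suc k ∸ j ∸ suc (2 ^ k)        ≡⟨ ∸-+-assoc (2 ^ suc k) j (suc (2 ^ k)) ⟩
  2 ^ suc k ∸ (j + suc (2 ^ k))      ≡⟨ cong (2 ^ suc k ∸_) (trans (+-suc j (2 ^ k)) (+-comm (suc j) (2 ^ k))) ⟩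
  2 ^ suc k ∸ (2 ^ k + suc j)        ≡⟨ ∸-+-assoc (2 ^ suc k) (2 ^ k) (suc j) ⟨
  -- The power `2 ^ suc k` unfolds to `2 ^ k + (2 ^ k + 0)`.
  2 ^ suc k ∸ 2 ^ k ∸ suc j          ≡⟨ cong (_∸ suc j) (m+n∸m≡n (2 ^ k) (2 ^ k + 0)) ⟩
  2 ^ k + 0 ∸ suc j                  ≡⟨ cong (_∸ suc j) (+-identityʳ (2 ^ k)) ⟩
  2 ^ k ∸ suc j                      ∎
  where open ≤-Reasoning

-- Otherwise monotonicity gives `⌈log₂ n ⌉ ≤ ⌈log₂ n ⌉ ∸ 1`. Positivity matters, as `0 ∸ 1` is `0`.
2^[⌈log₂n⌉∸1]<n : (n : ℕ) → 1 ≤ ⌈log₂ n ⌉ → 2 ^ (⌈log₂ n ⌉ ∸ 1) < n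
2^[⌈log₂n⌉∸1]<n n 1≤log = ≰⇒> λ n≤ → absurd ⌈log₂ n ⌉ 1≤log
  (≤-trans (⌈log₂⌉-mono-≤ n≤) (≤-reflexive (⌈log₂2^n⌉≡n (⌈log₂ n ⌉ ∸ 1))))
  where
  absurd : ∀ l → 1 ≤ l → ¬ (l ≤ l ∸ 1)
  absurd (suc l) _ = 1+n≰n

-- The extension `H` by all new traces is the required graph, and `R` consists of exactly the added
-- vertices, so deleting them gives `G` back.
odCode⇒removal : (G : Graph n) (C : Subset n) → ODCode G C → 2 ≤ ∣ C ∣ → 2 ^ (∣ C ∣ ∸ 1) < n → GᴼRemoval G ∣ C ∣
odCode⇒removal {n} G C code 2≤∣C∣ 2^<n =
  m⁺ , H , C⁺ , isGᴼ , R , R⊆∁C⁺ ,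
  -- Every subset of the code may be a trace here, hence `j` is 0.
  (λ _ → ∣R∣≤ 0 (subst (λ k → m⁺ ≤ 2 ^ k) ∣C⁺∣≡∣C∣ (odCode⇒n≤2^ H C⁺ codeH))) ,
  -- The empty trace stays free, hence `j` is 1.
  (λ noIsolated → ∣R∣≤ 1
    (subst (λ k → suc m⁺ ≤ 2 ^ k) ∣C⁺∣≡∣C∣ (odCode⇒suc-n≤2^ H C⁺ codeH noIsolated))) ,
  embedding⇒≅ G↪H (∁ R) (λ v → x∉p⇒x∈∁p (x∈p⇒x∉∁p (∈image⁺ old ∈⊤)))
    (λ w∈ → let v , _ , eq = ∈image⁻ old (x∉∁p⇒x∈p (x∈∁p⇒x∉p w∈)) in v , eq)
  where
  open NewTraces G C
  open Extension G C newTrace (λ j → proj₁ (proj₁ (newTrace-new j)))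

  m⁺ : ℕ
  m⁺ = n + ∣ news ∣

  ∣C⁺∣≡∣C∣ : ∣ C⁺ ∣ ≡ ∣ C ∣
  ∣C⁺∣≡∣C∣ = ∣image∣ old-injective C

  codeH : ODCode H C⁺
  codeH = odCode-H code newTrace-injective (λ j → proj₂ (proj₁ (newTrace-new j)))
    (λ j v eq → proj₂ (newTrace-new j) (v , eq))

  realise : ∀ D → D ⊆ C → Nonempty D → ∃ λ x → trace x ≡ D
  realise D D⊆C D≢∅ with realised? D
  ... | yes (v , eq) = inj₁ v , eq
  ... | no  ¬real    = let j , eq = newTrace-surjective ((D⊆C , D≢∅) , ¬real) in inj₂ j , eq

  isGᴼ : IsGᴼ H C⁺ ∣ C ∣
  isGᴼ = subst (IsGᴼ H C⁺) ∣C⁺∣≡∣C∣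
    (odCode⇒isGᴼ H C⁺ (subst (2 ≤_) (sym ∣C⁺∣≡∣C∣) 2≤∣C∣) codeH (realise-H realise))

  R : Subset m⁺
  R = ∁ (image old ⊤)

  R⊆∁C⁺ : R ⊆ ∁ C⁺
  R⊆∁C⁺ w∈R = x∉p⇒x∈∁p λ w∈C⁺ → let _ , _ , eq = ∈image⁻ old w∈C⁺ in
    x∈∁p⇒x∉p w∈R (subst (_∈ image old ⊤) eq (∈image⁺ old ∈⊤))

  ∣R∣≤ : ∀ j → j + m⁺ ≤ 2 ^ ∣ C ∣ → ∣ R ∣ ≤ 2 ^ (∣ C ∣ ∸ 1) ∸ suc j
  ∣R∣≤ j j+m⁺≤2^ = begin
    ∣ R ∣                      ≡⟨ ∣∁p∣≡n∸∣p∣ (image old ⊤) ⟩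
    m⁺ ∸ ∣ image old ⊤ ∣       ≡⟨ cong (m⁺ ∸_) (trans (∣image∣ old-injective ⊤) (∣⊤∣≡n n)) ⟩
    m⁺ ∸ n                     ≤⟨ removal-bound j (≤-trans (s≤s z≤n) 2≤∣C∣) 2^<n j+m⁺≤2^ ⟩
    2 ^ (∣ C ∣ ∸ 1) ∸ suc j    ∎
    where open ≤-Reasoning

-- Since `R` avoids `C`, the set `C` survives the removal and pulls back to an OD-code of `G`. An
-- upper bound on its size is enough, as the logarithm bounds every OD-code from below.
removal⇒odCode : {G : Graph n} → GᴼRemoval G k → ∃ λ D → ODCode G D × ∣ D ∣ ≤ k
removal⇒odCode (_ , H , C , isGᴼ , R , R⊆∁C , _ , _ , iso) =
  let ι , ∁R⊆emb = ≅⇒embedding {H = H} (∁ R) iso in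
  preimage (Embedding.emb ι) C ,
  odCode-preimage ι C (λ w∈C → ∁R⊆emb (x∉p⇒x∈∁p λ w∈R → x∈∁p⇒x∉p (R⊆∁C w∈R) w∈C)) (isGᴼ⇒odCode H C isGᴼ) ,
  ≤-trans (∣preimage∣≤ (Embedding.injective ι) C) (≤-reflexive (IsGᴼ.∣C∣≡k isGᴼ))

theorem4 : (n : ℕ) (G : Graph n) (admissible : ODAdmissible G) (k : ℕ) →
    k ≡ ⌈log₂ n ⌉ → 3 ≤ k →
    γᴼᴰ G admissible ≡ k ⇔
    (Σ ℕ λ m → Σ (Graph m) λ H → Σ (Subset m) λ C → IsGᴼ H C k ×
    (Σ (Subset m) λ R → R ⊆ ∁ C ×
    (HasIsolatedVertex (H [ C ]) → ∣ R ∣ ≤ 2 ^ (k ∸ 1) ∸ 1) ×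
    (¬ HasIsolatedVertex (H [ C ]) → ∣ R ∣ ≤ 2 ^ (k ∸ 1) ∸ 2) ×
    G ≅ H [ ∁ R ]))
theorem4 n G admissible k k≡log 3≤k with minimumODCode G admissible
... | C , code , minimal = mk⇔
  -- After the `with`, `γᴼᴰ` is the size of the minimum code `C`, so matching `refl` replaces `k` by
  -- `∣ C ∣`.
  (λ { refl → odCode⇒removal G C code (≤-trans (s≤s (s≤s z≤n)) 3≤k)
    (subst (λ l → 2 ^ (l ∸ 1) < n) (sym k≡log)
      (2^[⌈log₂n⌉∸1]<n n (≤-trans (s≤s z≤n) (≤-trans 3≤k (≤-reflexive k≡log))))) })
  (λ removal → let D , codeD , ∣D∣≤k = removal⇒odCode removal in
    ≤-antisym (≤-trans (minimal D codeD) ∣D∣≤k) k≤∣C∣)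
  where
  open ≤-Reasoning

  k≤∣C∣ : k ≤ ∣ C ∣
  k≤∣C∣ = begin
    k                    ≡⟨ k≡log ⟩
    ⌈log₂ n ⌉            ≤⟨ ⌈log₂⌉-mono-≤ (odCode⇒n≤2^ G C code) ⟩
    ⌈log₂ 2 ^ ∣ C ∣ ⌉    ≡⟨ ⌈log₂2^n⌉≡n ∣ C ∣ ⟩
    ∣ C ∣                ∎
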